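{- Consider the random basic walk on the integer lattice $\mathbb{Z}^2$ (vertices $\mathbb{Z}^2$, edges between points at Euclidean distance $1$). For any starting vertex and any initial port, the random basic walk cycles with probability $1$.
   Context: Graphs are connected, countable and locally finite; each undirected edge $\{v,w\}$ is regarded as two arcs $v\to w$ and $w\to v$. A labeling assigns, at each vertex $v$ of degree $\deg(v)$, the port numbers $1,\dots,\deg(v)$ bijectively to the arcs leaving $v$ (labels on $v\to w$ and $w\to v$ need not agree). In a random labeling these bijections are chosen uniformly at random, independently for different vertices. Given a labeling, a starting vertex $v_0$ and an initial port $\ell$, the basic walk leaves $v_0$ along the arc labeled $\ell$; thereafter, whenever it enters a vertex $v$ along an arc whose label (at the tail of that arc) is $i$, it leaves $v$ along the arc out of $v$ labeled $(i \bmod \deg(v))+1$. The random basic walk is the basic walk for a random labeling. The walk cycles if some arc is traversed twice in the same direction (equivalently, from some point on the walk is periodic and visits only finitely many vertices); it is transient if it does not cycle, i.e. it visits infinitely many vertices, each only finitely often. -}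

module Defs where

open import Axiom.UniquenessOfIdentityProofs using (module Decidable⇒UIP)
open import Data.Fin using (Fin; zero; suc; toℕ)
open import Data.Fin.Properties using (nonZeroIndex)
open import Data.Integer as ℤ using (ℤ; +_; -[1+_]; 0ℤ; 1ℤ; -1ℤ)
import Data.Integer.Properties as ℤ
open import Data.Integer.Tactic.RingSolver using (solve-∀)
open import Data.List using (List; map; foldr; applyUpTo)
open import Data.List.Relation.Unary.All using (All)
open import Data.List.Relation.Unary.Unique.Propositional using (Unique)
open import Data.Maybe using (Maybe; just; maybe′)
open import Data.Nat using (ℕ; zero; suc; _<_; _!; NonZero)
open import Data.Nat.DivMod using (_mod_)
open import Data.Nat.Properties using (_!≢0)
open import Data.Product using (Σ; Σ-syntax; ∃-syntax; _×_; _,_; proj₁; proj₂)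
open import Data.Rational as ℚ using (ℚ; 0ℚ; 1ℚ)
open import Function.Bundles using (_↔_; mk↔ₛ′; module Inverse)
open import Level using (0ℓ)
open import Relation.Binary.Construct.Closure.ReflexiveTransitive using (Star; ε; _◅_; _◅◅_; reverse)
open import Relation.Binary.PropositionalEquality
open import Relation.Nullary using (¬_)
open import Relation.Unary using (Pred; ∁)

-- Countability of the vertex set follows from connectedness and local
-- finiteness, so it is not a separate field.

record Graph : Set₁ where
  field
    V              : Set
    Adj            : V → V → Set
    Adj-irrelevant : ∀ {v w} (p q : Adj v w) → p ≡ q
    Adj-sym        : ∀ {v w} → Adj v w → Adj w v
    Adj-irrefl     : ∀ {v} → ¬ Adj v v
    connected      : ∀ v w → Star Adj v w

  Out : V → Set
  Out v = Σ[ w ∈ V ] Adj v w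

  field
    deg       : V → ℕ
    enumerate : ∀ v → Fin (deg v) ↔ Out v

module BasicWalk (G : Graph) where
  open Graph G

  -- Ports are numbered from 0: the element i of Fin (deg v) stands for
  -- the port number toℕ i + 1.

  LocalLabeling : V → Set
  LocalLabeling v = Fin (deg v) ↔ Out v

  Labeling : Set
  Labeling = ∀ v → LocalLabeling v

  deg-nonZero : ∀ {v w} → Adj v w → NonZero (deg v)
  deg-nonZero {v} {w} a = nonZeroIndex (Inverse.from (enumerate v) (w , a))

  State : Set
  State = Σ[ v ∈ V ] Fin (deg v)

  -- The rule i ↦ (i mod deg w) + 1 on port numbers is
  -- j ↦ (j + 1) mod deg w on ports numbered from 0.

  step : Labeling → State → State
  step ω (v , i) with Inverse.to (ω v) i
  ... | w , a = w , _mod_ (suc (toℕ i)) (deg w) {{deg-nonZero (Adj-sym a)}}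

  walk : Labeling → State → ℕ → State
  walk ω s zero    = s
  walk ω s (suc t) = step ω (walk ω s t)

  position : Labeling → State → ℕ → V
  position ω s t = proj₁ (walk ω s t)

  traversedArc : Labeling → State → ℕ → V × V
  traversedArc ω s t = position ω s t , position ω s (suc t)

  Cycles : (v₀ : V) → Fin (deg v₀) → Pred Labeling 0ℓ
  Cycles v₀ ℓ ω = ∃[ s ] ∃[ t ] s < t × traversedArc ω (v₀ , ℓ) s ≡ traversedArc ω (v₀ , ℓ) t

-- The law of the random labeling is the product over all vertices v of
-- the uniform distributions on the (deg v)! local labelings at v.
-- It is determined by its values on the cylinders that prescribe
-- the local labelings at finitely many distinct vertices; null sets are
-- those of outer measure zero.

module RandomLabeling (G : Graph) where
  open Graph G
  open BasicWalk G

  record Cylinder : Set where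
    field
      prescribed : List (Σ V LocalLabeling)
      distinct   : Unique (map proj₁ prescribed)

  open Cylinder

  -- Bijections are compared through their forward maps, pointwise.

  _∈ᶜ_ : Labeling → Cylinder → Set
  ω ∈ᶜ C = All (λ (v , β) → ∀ i → Inverse.to (ω v) i ≡ Inverse.to β i) (prescribed C)

  uniform : V → ℚ
  uniform v = ℚ._/_ 1ℤ (deg v !) {{deg v !≢0}}

  prob : Cylinder → ℚ
  prob C = foldr (λ (v , _) p → uniform v ℚ.* p) 1ℚ (prescribed C)

  -- A countable cover may use the empty set, represented by nothing.

  prob? : Maybe Cylinder → ℚ
  prob? = maybe′ prob 0ℚ

  partialSum : (ℕ → Maybe Cylinder) → ℕ → ℚ
  partialSum C n = foldr ℚ._+_ 0ℚ (applyUpTo (λ k → prob? (C k)) n)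

  Covers : (ℕ → Maybe Cylinder) → Pred Labeling 0ℓ → Set
  Covers C E = ∀ ω → E ω → ∃[ k ] ∃[ D ] C k ≡ just D × ω ∈ᶜ D

  Null : Pred Labeling 0ℓ → Set
  Null E = ∀ δ → 0ℚ ℚ.< δ → ∃[ C ] Covers C E × (∀ n → partialSum C n ℚ.≤ δ)

  WithProbabilityOne : Pred Labeling 0ℓ → Set
  WithProbabilityOne E = Null (∁ E)

module Lattice where

  Point : Set
  Point = ℤ × ℤ

  sqDist : Point → Point → ℤ
  sqDist (x , y) (x′ , y′) =
    (x′ ℤ.- x) ℤ.* (x′ ℤ.- x) ℤ.+ (y′ ℤ.- y) ℤ.* (y′ ℤ.- y)

  -- Euclidean distance 1 is the same as squared Euclidean distance 1.

  Adj : Point → Point → Set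
  Adj p q = sqDist p q ≡ 1ℤ

  sqDist-sym : ∀ p q → sqDist q p ≡ sqDist p q
  sqDist-sym (x , y) (x′ , y′) = lemma x y x′ y′
    where
    lemma : ∀ x y x′ y′ →
            (x ℤ.- x′) ℤ.* (x ℤ.- x′) ℤ.+ (y ℤ.- y′) ℤ.* (y ℤ.- y′) ≡
            (x′ ℤ.- x) ℤ.* (x′ ℤ.- x) ℤ.+ (y′ ℤ.- y) ℤ.* (y′ ℤ.- y)
    lemma = solve-∀

  sqDist-refl : ∀ x y → (x ℤ.- x) ℤ.* (x ℤ.- x) ℤ.+ (y ℤ.- y) ℤ.* (y ℤ.- y) ≡ 0ℤ
  sqDist-refl = solve-∀

  Adj-irrefl : ∀ {p} → ¬ Adj p p
  Adj-irrefl {x , y} a with () ← trans (sym (sqDist-refl x y)) a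

  dir : Fin 4 → Point
  dir zero                   = 1ℤ , 0ℤ
  dir (suc zero)             = 0ℤ , 1ℤ
  dir (suc (suc zero))       = -1ℤ , 0ℤ
  dir (suc (suc (suc zero))) = 0ℤ , -1ℤ

  _⊕_ : Point → Point → Point
  (x , y) ⊕ (a , b) = x ℤ.+ a , y ℤ.+ b

  _⊖_ : Point → Point → Point
  (x , y) ⊖ (a , b) = x ℤ.- a , y ℤ.- b

  ⊕-⊖ : ∀ p d → (p ⊕ d) ⊖ p ≡ d
  ⊕-⊖ (x , y) (a , b) = cong₂ _,_ (lemma x a) (lemma y b)
    where
    lemma : ∀ x a → (x ℤ.+ a) ℤ.- x ≡ a
    lemma = solve-∀

  ⊖-⊕ : ∀ p q → p ⊕ (q ⊖ p) ≡ q
  ⊖-⊕ (x , y) (a , b) = cong₂ _,_ (lemma x a) (lemma y b)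
    where
    lemma : ∀ x a → x ℤ.+ (a ℤ.- x) ≡ a
    lemma = solve-∀

  normSq : Point → ℤ
  normSq (a , b) = a ℤ.* a ℤ.+ b ℤ.* b

  normSq-dir : ∀ i → normSq (dir i) ≡ 1ℤ
  normSq-dir zero                   = refl
  normSq-dir (suc zero)             = refl
  normSq-dir (suc (suc zero))       = refl
  normSq-dir (suc (suc (suc zero))) = refl

  unit-dir : ∀ d → normSq d ≡ 1ℤ → Σ[ i ∈ Fin 4 ] dir i ≡ d
  unit-dir (+ 0 , + 0)               ()
  unit-dir (+ 0 , + 1)               _ = suc zero , refl
  unit-dir (+ 0 , + suc (suc _))     ()
  unit-dir (+ 0 , -[1+ 0 ])          _ = suc (suc (suc zero)) , refl
  unit-dir (+ 0 , -[1+ suc _ ])      ()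
  unit-dir (+ 1 , + 0)               _ = zero , refl
  unit-dir (+ 1 , + suc _)           ()
  unit-dir (+ 1 , -[1+ _ ])          ()
  unit-dir (+ suc (suc _) , + 0)     ()
  unit-dir (+ suc (suc _) , + suc _) ()
  unit-dir (+ suc (suc _) , -[1+ _ ]) ()
  unit-dir (-[1+ 0 ] , + 0)          _ = suc (suc zero) , refl
  unit-dir (-[1+ 0 ] , + suc _)      ()
  unit-dir (-[1+ 0 ] , -[1+ _ ])     ()
  unit-dir (-[1+ suc _ ] , + 0)      ()
  unit-dir (-[1+ suc _ ] , + suc _)  ()
  unit-dir (-[1+ suc _ ] , -[1+ _ ]) ()

  dir-injective : ∀ i j → dir i ≡ dir j → i ≡ j
  dir-injective i j e = trans (sym (code-dir i)) (trans (cong code e) (code-dir j))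
    where
    code : Point → Fin 4
    code (+ 0 , + _)      = suc zero
    code (+ 0 , -[1+ _ ]) = suc (suc (suc zero))
    code (+ suc _ , _)    = zero
    code (-[1+ _ ] , _)   = suc (suc zero)

    code-dir : ∀ i → code (dir i) ≡ i
    code-dir zero                   = refl
    code-dir (suc zero)             = refl
    code-dir (suc (suc zero))       = refl
    code-dir (suc (suc (suc zero))) = refl

  Out : Point → Set
  Out p = Σ[ q ∈ Point ] Adj p q

  Out-≡ : ∀ {p} {a b : Out p} → proj₁ a ≡ proj₁ b → a ≡ b
  Out-≡ {a = q , a} {b = .q , b} refl = cong (q ,_) (Decidable⇒UIP.≡-irrelevant ℤ._≟_ a b)

  Adj-⊕ : ∀ p i → Adj p (p ⊕ dir i)
  Adj-⊕ p i = trans (cong normSq (⊕-⊖ p (dir i))) (normSq-dir i)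

  enumerate : ∀ p → Fin 4 ↔ Out p
  enumerate p = mk↔ₛ′ to from to∘from from∘to
    where
    to : Fin 4 → Out p
    to i = p ⊕ dir i , Adj-⊕ p i

    from : Out p → Fin 4
    from (q , a) = proj₁ (unit-dir (q ⊖ p) a)

    to∘from : ∀ o → to (from o) ≡ o
    to∘from (q , a) = Out-≡ (trans (cong (p ⊕_) (proj₂ (unit-dir (q ⊖ p) a))) (⊖-⊕ p q))

    from∘to : ∀ i → from (to i) ≡ i
    from∘to i = dir-injective _ i
      (trans (proj₂ (unit-dir ((p ⊕ dir i) ⊖ p) (Adj-⊕ p i))) (⊕-⊖ p (dir i)))

  Adj-sym : ∀ {p q} → Adj p q → Adj q p
  Adj-sym {p} {q} a = trans (sqDist-sym p q) a

  hop : ∀ p i {q r} → p ⊕ dir i ≡ q → Star Adj q r → Star Adj p r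
  hop p i refl path = Adj-⊕ p i ◅ path

  toOrigin : ∀ p → Star Adj p (0ℤ , 0ℤ)
  toOrigin (x , y) = horizontal x ◅◅ vertical y
    where
    vertical : ∀ b → Star Adj (0ℤ , b) (0ℤ , 0ℤ)
    vertical (+ zero)         = ε
    vertical b@(+ suc n)      = hop (0ℤ , b) (suc (suc (suc zero))) refl (vertical (+ n))
    vertical b@(-[1+ zero ])  = hop (0ℤ , b) (suc zero) refl ε
    vertical b@(-[1+ suc n ]) = hop (0ℤ , b) (suc zero) refl (vertical -[1+ n ])

    y+0 : ∀ {a : ℤ} → (a , y ℤ.+ 0ℤ) ≡ (a , y)
    y+0 {a} = cong (a ,_) (ℤ.+-identityʳ y)

    horizontal : ∀ a → Star Adj (a , y) (0ℤ , y)
    horizontal (+ zero)         = ε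
    horizontal a@(+ suc n)      = hop (a , y) (suc (suc zero)) y+0 (horizontal (+ n))
    horizontal a@(-[1+ zero ])  = hop (a , y) zero y+0 ε
    horizontal a@(-[1+ suc n ]) = hop (a , y) zero y+0 (horizontal -[1+ n ])

  connected : ∀ p q → Star Adj p q
  connected p q = toOrigin p ◅◅ reverse (λ {p} {q} → Adj-sym {p} {q}) (toOrigin q)

ℤ² : Graph
ℤ² = record
  { V              = Lattice.Point
  ; Adj            = Lattice.Adj
  ; Adj-irrelevant = Decidable⇒UIP.≡-irrelevant ℤ._≟_
  ; Adj-sym        = λ {p} {q} → Lattice.Adj-sym {p} {q}
  ; Adj-irrefl     = λ {p} → Lattice.Adj-irrefl {p}
  ; connected      = Lattice.connected
  ; deg            = λ _ → 4
  ; enumerate      = Lattice.enumerate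
  }

{-# OPTIONS --safe #-}
module Submission where

-- All degrees are 4, so the port used at time t is ℓ + t modulo 4.  Suppose
-- the walk arrives with port p at a vertex u such that u and two opposite
-- neighbours a, b of u are still unexplored.  With probability at least 24⁻³
-- their labelings make it run u → a → u → b → u, after which it is at u with
-- port p again and cycles.  Otherwise reveal the labelings of a finite rectangle
-- containing everything explored so far, including a and b.  If the walk stays
-- inside, it repeats a state by pigeonhole.  If it leaves the rectangle, then at
-- the first vertex outside either the vertical or the horizontal line through
-- that vertex misses the rectangle, so the situation recurs.  After N rounds the
-- labelings not known to cycle are covered by finitely many cylinders of total
-- probability at most (1 - 24⁻³)ᴺ.

open import Defs
open import Data.Fin using (Fin; zero; suc; toℕ; punchIn; punchOut)
open import Data.Fin.Patterns using (0F; 1F; 2F; 3F)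
open import Data.Fin.Permutation as Perm using (Permutation′; _⟨$⟩ʳ_; _∘ₚ_; insert; remove; insert-remove)
import Data.Fin.Properties as Fin
import Data.Integer as ℤ
import Data.Integer.Properties as ℤ
open import Data.List using (List; []; _∷_; _++_; map; concatMap; foldr; length; lookup; allFin; cartesianProduct; filter; deduplicate)
open import Data.List.Membership.Propositional using (_∈_; _∉_; lose; find)
open import Data.List.Membership.Propositional.Properties using (∈-map⁺; ∈-concatMap⁺; ∈-cartesianProduct⁺; ∈-cartesianProduct⁻; ∈-allFin; ∈-filter⁺; ∈-filter⁻; ∈-deduplicate⁺; ∈-deduplicate⁻; ∈-++⁺ˡ; ∈-++⁺ʳ; ∈-++⁻)
import Data.List.Membership.DecPropositional as DecMembership
open import Data.List.Relation.Unary.All as All using (All; []; _∷_)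
import Data.List.Relation.Unary.All.Properties as All
open import Data.List.Relation.Unary.AllPairs using ([]; _∷_)
open import Data.List.Relation.Unary.Any as Any using (Any; here; there; index)
import Data.List.Relation.Unary.Any.Properties as Any
open import Data.List.Relation.Unary.Unique.Propositional using (Unique)
open import Data.List.Relation.Unary.Unique.DecPropositional.Properties using (deduplicate-!)
import Data.List.Relation.Unary.Unique.Propositional.Properties as Unique
open import Data.Maybe using (Maybe; just; nothing)
open import Data.Nat using (ℕ; zero; suc; _<_; z<s)
open import Data.Nat.DivMod using (_mod_)
import Data.Nat as ℕ
import Data.Nat.Properties as ℕ
open import Data.Product using (Σ; Σ-syntax; ∃-syntax; _×_; _,_; proj₁; proj₂)
open import Data.Product.Properties using (≡-dec)
open import Data.Rational as ℚ using (ℚ; 0ℚ; 1ℚ; _+_; _-_; _*_; _≤_; mkℚ; toℚᵘ; fromℚᵘ)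
import Data.Rational.Properties as ℚ
open import Data.Rational.Solver using (module +-*-Solver)
open import Data.Rational.Unnormalised as ℚᵘ using (mkℚᵘ; 1ℚᵘ)
import Data.Rational.Unnormalised.Properties as ℚᵘ
open import Data.Unit using (⊤)
open import Data.Sum using (_⊎_; inj₁; inj₂; [_,_]′)
open import Function using (_∘_)
open import Function.Bundles using (_↔_; module Inverse)
open import Function.Construct.Composition using (_↔-∘_)
open import Function.Construct.Symmetry using (↔-sym)
open import Level using (0ℓ)
open import Relation.Binary.Definitions using (DecidableEquality)
open import Relation.Binary.PropositionalEquality
open import Relation.Nullary using (¬_; yes; no; contradiction)
open import Relation.Nullary.Decidable using (from-yes)
open import Relation.Unary using (Pred; Decidable; _∪_)

open Graph ℤ² using (V)
open BasicWalk ℤ²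
open RandomLabeling ℤ²
open Lattice using (dir; _⊕_; ⊕-⊖; dir-injective; enumerate)

private
  variable
    A B : Set

-- Sums over lists of rationals

total : (A → ℚ) → List A → ℚ
total f = foldr (λ x q → f x + q) 0ℚ

total-++ : (f : A → ℚ) (xs ys : List A) → total f (xs ++ ys) ≡ total f xs + total f ys
total-++ f []       ys = sym (ℚ.+-identityˡ _)
total-++ f (x ∷ xs) ys = trans (cong (f x +_) (total-++ f xs ys)) (sym (ℚ.+-assoc (f x) _ _))

total-map : (f : B → ℚ) (g : A → B) (xs : List A) → total f (map g xs) ≡ total (f ∘ g) xs
total-map f g []       = refl
total-map f g (x ∷ xs) = cong (f (g x) +_) (total-map f g xs)

total-concatMap : (f : B → ℚ) (g : A → List B) (h : A → ℚ) → (∀ x → total f (g x) ≡ h x) →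
                  ∀ xs → total f (concatMap g xs) ≡ total h xs
total-concatMap f g h eq []       = refl
total-concatMap f g h eq (x ∷ xs) =
  trans (total-++ f (g x) (concatMap g xs)) (cong₂ _+_ (eq x) (total-concatMap f g h eq xs))

total-*ʳ : (f : A → ℚ) (q : ℚ) (xs : List A) → total (λ x → f x * q) xs ≡ total f xs * q
total-*ʳ f q []       = sym (ℚ.*-zeroˡ q)
total-*ʳ f q (x ∷ xs) = trans (cong (f x * q +_) (total-*ʳ f q xs)) (sym (ℚ.*-distribʳ-+ q (f x) _))

total-*ˡ : (q : ℚ) (f : A → ℚ) (xs : List A) → total (λ x → q * f x) xs ≡ q * total f xs
total-*ˡ q f []       = sym (ℚ.*-zeroʳ q)
total-*ˡ q f (x ∷ xs) = trans (cong (q * f x +_) (total-*ˡ q f xs)) (sym (ℚ.*-distribˡ-+ q (f x) _))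

-- Geometric decay

power : ℚ → ℕ → ℚ
power q zero    = 1ℚ
power q (suc n) = q * power q n

fromℕ : ℕ → ℚ
fromℕ n = fromℚᵘ (mkℚᵘ (ℤ.+ n) 0)

fromℕ-suc : ∀ n → fromℕ (suc n) ≡ 1ℚ + fromℕ n
fromℕ-suc n = ℚ.toℚᵘ-injective (begin
  toℚᵘ (fromℕ (suc n))              ≈⟨ ℚ.toℚᵘ-fromℚᵘ _ ⟩
  mkℚᵘ (ℤ.+ suc n) 0                ≈⟨ ℚᵘ.*≡* (cong (λ i → (ℤ.1ℤ ℤ.+ i) ℤ.* ℤ.1ℤ) (sym (ℤ.*-identityʳ (ℤ.+ n)))) ⟩
  1ℚᵘ ℚᵘ.+ mkℚᵘ (ℤ.+ n) 0           ≈⟨ ℚᵘ.+-congʳ 1ℚᵘ (ℚ.toℚᵘ-fromℚᵘ (mkℚᵘ (ℤ.+ n) 0)) ⟨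
  1ℚᵘ ℚᵘ.+ toℚᵘ (fromℕ n)           ≈⟨ ℚ.toℚᵘ-homo-+ 1ℚ (fromℕ n) ⟨
  toℚᵘ (1ℚ + fromℕ n)               ∎)
  where open ℚᵘ.≃-Reasoning

fromℕ-nonNeg : ∀ n → ℚ.NonNegative (fromℕ n)
fromℕ-nonNeg n = ℚ.normalize-nonNeg n 1

-- For `q` = (m+1)/(d+1) the denominator d+1 serves, the product being m+1.
archimedean : ∀ q .{{_ : ℚ.Positive q}} → ∃[ n ] 1ℚ ≤ fromℕ n * q
archimedean q@(mkℚ ℤ.+[1+ m ] d _) = suc d , ℚ.toℚᵘ-cancel-≤ (begin
  1ℚᵘ                               ≤⟨ ℚᵘ.*≤* (ℤ.+≤+ bound) ⟩
  mkℚᵘ (ℤ.+ suc d) 0 ℚᵘ.* toℚᵘ q    ≃⟨ ℚᵘ.*-congʳ {toℚᵘ q} (ℚ.toℚᵘ-fromℚᵘ (mkℚᵘ (ℤ.+ suc d) 0)) ⟨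
  toℚᵘ (fromℕ (suc d)) ℚᵘ.* toℚᵘ q  ≃⟨ ℚ.toℚᵘ-homo-* (fromℕ (suc d)) q ⟨
  toℚᵘ (fromℕ (suc d) * q)          ∎)
  where
  open ℚᵘ.≤-Reasoning
  bound : 1 ℕ.* (1 ℕ.* suc d) ℕ.≤ suc d ℕ.* suc m ℕ.* 1
  bound = subst₂ ℕ._≤_ (sym (trans (ℕ.*-identityˡ _) (ℕ.*-identityˡ (suc d)))) (sym (ℕ.*-identityʳ _))
            (ℕ.m≤m*n (suc d) (suc m))

power-nonNeg : ∀ q .{{_ : ℚ.NonNegative q}} n → ℚ.NonNegative (power q n)
power-nonNeg q zero    = _
power-nonNeg q (suc n) = ℚ.nonNeg*nonNeg⇒nonNeg q (power q n) {{power-nonNeg q n}}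

-- By induction: from n to n+1 the left side drops by (1-c)^n c^2 (1+n), which is nonnegative.
bernoulli : ∀ c .{{_ : ℚ.NonNegative c}} .{{_ : ℚ.NonNegative (1ℚ - c)}} n →
            power (1ℚ - c) n * (1ℚ + fromℕ n * c) ≤ 1ℚ
bernoulli c zero = ℚ.≤-reflexive (trans (ℚ.*-identityˡ _) (trans (cong (1ℚ +_) (ℚ.*-zeroˡ c)) (ℚ.+-identityʳ 1ℚ)))
bernoulli c (suc n) = begin
  (1ℚ - c) * x * (1ℚ + fromℕ (suc n) * c)
    ≡⟨ cong (λ m → (1ℚ - c) * x * (1ℚ + m * c)) (fromℕ-suc n) ⟩
  (1ℚ - c) * x * (1ℚ + (1ℚ + y) * c)
    ≡⟨ identity c x y ⟩
  x * (1ℚ + y * c) + ℚ.- (x * (c * c * (1ℚ + y)))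
    ≤⟨ ℚ.+-monoʳ-≤ (x * (1ℚ + y * c)) (ℚ.neg-antimono-≤ (ℚ.nonNegative⁻¹ _ {{defect}})) ⟩
  x * (1ℚ + y * c) + 0ℚ
    ≡⟨ ℚ.+-identityʳ _ ⟩
  x * (1ℚ + y * c)
    ≤⟨ bernoulli c n ⟩
  1ℚ ∎
  where
  open ℚ.≤-Reasoning
  x = power (1ℚ - c) n
  y = fromℕ n

  identity : ∀ c x y → (1ℚ - c) * x * (1ℚ + (1ℚ + y) * c) ≡ x * (1ℚ + y * c) + ℚ.- (x * (c * c * (1ℚ + y)))
  identity = solve 3 (λ c x y → (con 1ℚ :- c) :* x :* (con 1ℚ :+ (con 1ℚ :+ y) :* c) :=
                                 x :* (con 1ℚ :+ y :* c) :+ :- (x :* (c :* c :* (con 1ℚ :+ y)))) refl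
    where open +-*-Solver

  defect : ℚ.NonNegative (x * (c * c * (1ℚ + y)))
  defect = ℚ.nonNeg*nonNeg⇒nonNeg x {{power-nonNeg (1ℚ - c) n}} _
    {{ℚ.nonNeg*nonNeg⇒nonNeg (c * c) {{ℚ.nonNeg*nonNeg⇒nonNeg c c}} (1ℚ + y)
      {{ℚ.nonNeg+nonNeg⇒nonNeg 1ℚ y {{fromℕ-nonNeg n}}}}}}

-- Once 1 ≤ n c δ, Bernoulli gives (1-c)^n (1+nc) ≤ 1 ≤ δ (1+nc), and the positive factor cancels.
power-vanishes : ∀ c .{{_ : ℚ.Positive c}} .{{_ : ℚ.NonNegative (1ℚ - c)}} →
                 ∀ δ .{{_ : ℚ.Positive δ}} → ∃[ n ] power (1ℚ - c) n ≤ δ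
power-vanishes c δ with archimedean (c * δ) {{ℚ.pos*pos⇒pos c δ}}
... | n , 1≤ncδ = n , ℚ.*-cancelʳ-≤-pos s {{positive-s}} (begin
  x * s                   ≤⟨ bernoulli c {{ℚ.pos⇒nonNeg c}} n ⟩
  1ℚ                      ≤⟨ 1≤ncδ ⟩
  y * (c * δ)             ≡⟨ ℚ.+-identityˡ _ ⟨
  0ℚ + y * (c * δ)        ≤⟨ ℚ.+-monoˡ-≤ (y * (c * δ)) (ℚ.nonNegative⁻¹ δ {{ℚ.pos⇒nonNeg δ}}) ⟩
  δ + y * (c * δ)         ≡⟨ identity c δ y ⟩
  δ * s                   ∎)
  where
  open ℚ.≤-Reasoning
  x = power (1ℚ - c) n
  y = fromℕ n
  s = 1ℚ + y * c

  identity : ∀ c δ y → δ + y * (c * δ) ≡ δ * (1ℚ + y * c)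
  identity = solve 3 (λ c δ y → δ :+ y :* (c :* δ) := δ :* (con 1ℚ :+ y :* c)) refl
    where open +-*-Solver

  positive-s : ℚ.Positive s
  positive-s = ℚ.pos+nonNeg⇒pos 1ℚ (y * c)
    {{ℚ.nonNeg*nonNeg⇒nonNeg y {{fromℕ-nonNeg n}} c {{ℚ.pos⇒nonNeg c}}}}

-- Local labelings

permutations : ∀ n → List (Permutation′ n)
permutations zero    = Perm.id ∷ []
permutations (suc n) = concatMap (λ j → map (insert zero j) (permutations n)) (allFin (suc n))

insert-cong : ∀ {n} (i j : Fin (suc n)) {π ρ : Permutation′ n} → π Perm.≈ ρ → insert i j π Perm.≈ insert i j ρ
insert-cong i j eq k with i Fin.≟ k
... | yes _  = refl
... | no i≢k = cong (punchIn j) (eq (punchOut i≢k))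

-- Split off the image of zero and recurse on the rest. Agreement is pointwise, matching how `_∈ᶜ_`
-- compares labelings.
permutations-complete : ∀ {n} (π : Permutation′ n) → Any (Perm._≈ π) (permutations n)
permutations-complete {zero}  π = here λ ()
permutations-complete {suc n} π = Any.concatMap⁺ (λ j → map (insert zero j) (permutations n))
  (lose (∈-allFin (π ⟨$⟩ʳ zero)) (Any.map⁺ (Any.map lift (permutations-complete (remove zero π)))))
  where
  lift : ∀ {ρ} → ρ Perm.≈ remove zero π → insert zero (π ⟨$⟩ʳ zero) ρ Perm.≈ π
  lift eq k = trans (insert-cong zero (π ⟨$⟩ʳ zero) eq k) (insert-remove zero π k)

infix 4 _≗ˡ_

_≗ˡ_ : ∀ {n} → Fin n ↔ A → Fin n ↔ A → Set
β ≗ˡ γ = ∀ i → Inverse.to β i ≡ Inverse.to γ i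

bijections : ∀ {n} → Fin n ↔ A → List (Fin n ↔ A)
bijections e = map (e ↔-∘_) (permutations _)

-- `β` is `e` composed with the permutation that undoes `e` after `β`, and that permutation is
-- listed.
bijections-complete : ∀ {n} (e β : Fin n ↔ A) → Any (β ≗ˡ_) (bijections e)
bijections-complete e β = Any.map⁺ (Any.map (λ {π} → agree π) (permutations-complete (↔-sym e ↔-∘ β)))
  where
  agree : ∀ π → π Perm.≈ (↔-sym e ↔-∘ β) → β ≗ˡ (e ↔-∘ π)
  agree π eq i = sym (trans (cong (Inverse.to e) (eq i)) (Inverse.strictlyInverseˡ e (Inverse.to β i)))

abstract
  labelings : ∀ v → List (LocalLabeling v)
  labelings v = bijections (enumerate v)

  labelings-complete : ∀ {v} (β : LocalLabeling v) → Any (β ≗ˡ_) (labelings v)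
  labelings-complete {v} β = bijections-complete (enumerate v) β

  -- Twenty-four terms 1/24, evaluated here once; `abstract` keeps the list of labelings folded
  -- afterwards.
  labelings-uniform : ∀ v → total (λ _ → uniform v) (labelings v) ≡ 1ℚ
  labelings-uniform v = refl

-- Port rotations and lattice directions

next : Fin 4 → Fin 4
next i = suc (toℕ i) mod 4

next⁴ : ∀ i → next (next (next (next i))) ≡ i
next⁴ 0F = refl
next⁴ 1F = refl
next⁴ 2F = refl
next⁴ 3F = refl

rotation : Permutation′ 4
rotation = Perm.permutation next (next ∘ next ∘ next) next⁴ next⁴

rotations : ℕ → Permutation′ 4
rotations zero    = Perm.id
rotations (suc n) = rotations n ∘ₚ rotation

rotations-next : ∀ n p → rotations n ⟨$⟩ʳ next p ≡ next (rotations n ⟨$⟩ʳ p)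
rotations-next zero    p = refl
rotations-next (suc n) p = cong next (rotations-next n p)

-- Since 3 is -1 modulo 4, the exponent is i - p written without subtraction; the 16 cases are
-- evaluated.
rotate-to : ∀ p i → rotations (toℕ i ℕ.+ 3 ℕ.* toℕ p) ⟨$⟩ʳ p ≡ i
rotate-to = from-yes (Fin.all? λ p → Fin.all? λ i → rotations (toℕ i ℕ.+ 3 ℕ.* toℕ p) ⟨$⟩ʳ p Fin.≟ i)

-- On directions, which `dir` lists counterclockwise, this is the opposite one; on ports, the shift
-- made by two steps of the walk.
back : Fin 4 → Fin 4
back = next ∘ next

-- Rotations commute with `next`, so sending `p` to `i` also sends opposite to opposite. One
-- labeling at the centre thus serves both departures of the loop, which are two steps apart.
turn : ∀ p i → ∃[ π ] (π ⟨$⟩ʳ p ≡ i) × (π ⟨$⟩ʳ back p ≡ back i)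
turn p i = rotations n , rotate-to p i ,
  trans (rotations-next n (next p)) (trans (cong next (rotations-next n p)) (cong back (rotate-to p i)))
  where n = toℕ i ℕ.+ 3 ℕ.* toℕ p

⊕-back : ∀ v i → (v ⊕ dir i) ⊕ dir (back i) ≡ v
⊕-back (x , y) i = cong₂ _,_ (shift x (proj₁ (cancel i))) (shift y (proj₂ (cancel i)))
  where
  shift : ∀ z {a b} → a ℤ.+ b ≡ ℤ.0ℤ → (z ℤ.+ a) ℤ.+ b ≡ z
  shift z {a} {b} eq = trans (ℤ.+-assoc z a b) (trans (cong (λ c → z ℤ.+ c) eq) (ℤ.+-identityʳ z))

  cancel : ∀ i → (proj₁ (dir i) ℤ.+ proj₁ (dir (back i)) ≡ ℤ.0ℤ) ×
                 (proj₂ (dir i) ℤ.+ proj₂ (dir (back i)) ≡ ℤ.0ℤ)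
  cancel 0F = refl , refl
  cancel 1F = refl , refl
  cancel 2F = refl , refl
  cancel 3F = refl , refl

back-≢ : ∀ i → i ≢ back i
back-≢ 0F ()
back-≢ 1F ()
back-≢ 2F ()
back-≢ 3F ()

⊕-injectiveʳ : ∀ v i j → v ⊕ dir i ≡ v ⊕ dir j → i ≡ j
⊕-injectiveʳ v i j eq = dir-injective i j
  (trans (sym (⊕-⊖ v (dir i))) (trans (cong (Lattice._⊖ v) eq) (⊕-⊖ v (dir j))))

⊕-irrefl : ∀ v i → v ⊕ dir i ≢ v
⊕-irrefl v i eq = Lattice.Adj-irrefl {v} (subst (Lattice.Adj v) eq (Lattice.Adj-⊕ v i))

step-cong : ∀ {ω ω′ : Labeling} v i → Inverse.to (ω v) i ≡ Inverse.to (ω′ v) i →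
            step ω (v , i) ≡ step ω′ (v , i)
step-cong v i eq = cong (λ o → proj₁ o , next i) eq

-- Equal states have equal successors, so the arcs leaving them coincide.
repeat⇒cycles : ∀ {v₀ ℓ ω s t} → s < t → walk ω (v₀ , ℓ) s ≡ walk ω (v₀ , ℓ) t → Cycles v₀ ℓ ω
repeat⇒cycles {ω = ω} s<t eq = _ , _ , s<t , cong (λ σ → proj₁ σ , proj₁ (step ω σ)) eq

-- Prescriptions of finitely many local labelings

Prescription : Set
Prescription = List (Σ V LocalLabeling)

domain : Prescription → List V
domain = map proj₁

infix 4 _∈ᵖ_

_∈ᵖ_ : Labeling → Prescription → Set
ω ∈ᵖ L = All (λ (v , β) → ω v ≗ˡ β) L

-- The fold that defines `prob`, on bare lists, so that refinements can be weighed before they are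
-- packed as cylinders.
weight : Prescription → ℚ
weight = foldr (λ (v , _) p → uniform v * p) 1ℚ

cell : ℚ
cell = ℤ.1ℤ ℚ./ 24

weight-nonNeg : ∀ L → ℚ.NonNegative (weight L)
weight-nonNeg []      = _
weight-nonNeg (_ ∷ L) = ℚ.nonNeg*nonNeg⇒nonNeg cell (weight L) {{weight-nonNeg L}}

prescribe : ∀ v → Prescription → LocalLabeling v → Prescription
prescribe v L β = (v , β) ∷ L

refineAt : V → Prescription → List Prescription
refineAt v L = map (prescribe v L) (labelings v)

refine : List V → Prescription → List Prescription
refine []      L = L ∷ []
refine (v ∷ F) L = concatMap (refineAt v) (refine F L)

-- Each vertex splits a prescription into 24 extensions whose factors 1/24 add up to 1.
refine-total : ∀ F L → total weight (refine F L) ≡ weight L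
refine-total []      L = ℚ.+-identityʳ (weight L)
refine-total (v ∷ F) L = trans (total-concatMap weight (refineAt v) weight preserved (refine F L)) (refine-total F L)
  where
  preserved : ∀ D → total weight (refineAt v D) ≡ weight D
  preserved D = trans (total-map weight (prescribe v D) (labelings v))
    (trans (total-*ʳ (λ _ → uniform v) (weight D) (labelings v))
    (trans (cong (_* weight D) (labelings-uniform v)) (ℚ.*-identityˡ (weight D))))

refine-complete : ∀ F {L} ω → ω ∈ᵖ L → Any (ω ∈ᵖ_) (refine F L)
refine-complete []      ω ω∈L = here ω∈L
refine-complete (v ∷ F) ω ω∈L = Any.concatMap⁺ (refineAt v)
  (Any.map (λ {D} ω∈D → Any.map⁺ {f = prescribe v D} (Any.map (_∷ ω∈D) (labelings-complete {v} (ω v))))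
    (refine-complete F ω ω∈L))

refine-domain : ∀ F L → All (λ D → domain D ≡ F ++ domain L) (refine F L)
refine-domain []      L = refl ∷ []
refine-domain (v ∷ F) L = All.concat⁺ (All.map⁺ (All.map
  (λ eq → All.map⁺ (All.universal (λ _ → cong (v ∷_) eq) (labelings v)))
  (refine-domain F L)))

refine-∈ : ∀ {v F L D β} → β ∈ labelings v → D ∈ refine F L → (v , β) ∷ D ∈ refine (v ∷ F) L
refine-∈ {v} β∈ D∈ = ∈-concatMap⁺ (refineAt v) (Any.map (λ { refl → ∈-map⁺ (prescribe v _) β∈ }) D∈)

_≟ᵛ_ : DecidableEquality V
_≟ᵛ_ = ≡-dec ℤ._≟_ ℤ._≟_

open DecMembership _≟ᵛ_ using (_∈?_; _∉?_)

assign : Prescription → Labeling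
-- An arbitrary default: walks are compared only while they depart from prescribed vertices.
assign []            v = enumerate v
assign ((w , β) ∷ L) v with w ≟ᵛ v
... | yes refl = β
... | no  _    = assign L v

assign-agrees : ∀ L ω {v} → ω ∈ᵖ L → v ∈ domain L → ω v ≗ˡ assign L v
assign-agrees ((w , β) ∷ L) ω {v} (eq ∷ ω∈L) v∈ with w ≟ᵛ v | v∈
... | yes refl | _          = eq
... | no  w≢v  | here refl  = contradiction refl w≢v
... | no  _    | there v∈L  = assign-agrees L ω ω∈L v∈L

-- The state at time t depends only on labelings at earlier positions, so the position at t itself
-- may lie outside the domain. The condition concerns the single walk of `assign L`, which then
-- decides for all `ω` at once.
walk-agrees : ∀ L ω σ t → ω ∈ᵖ L → (∀ s → s < t → position (assign L) σ s ∈ domain L) →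
              walk ω σ t ≡ walk (assign L) σ t
walk-agrees L ω σ zero    ω∈L inside = refl
walk-agrees L ω σ (suc t) ω∈L inside = trans
  (cong (step ω) (walk-agrees L ω σ t ω∈L λ s s<t → inside s (ℕ.m<n⇒m<1+n s<t)))
  (step-cong {ω} {assign L} v i (assign-agrees L ω ω∈L (inside t ℕ.≤-refl) i))
  where
  v = proj₁ (walk (assign L) σ t)
  i = proj₂ (walk (assign L) σ t)

-- First failures, pigeonhole and rectangles

first-failure : {P : Pred ℕ 0ℓ} → Decidable P → ∀ T →
                (∃[ t ] ¬ P t × (∀ s → s < t → P s)) ⊎ (∀ s → s < T → P s)
first-failure P? zero = inj₂ λ _ ()
first-failure P? (suc T) with first-failure P? T
... | inj₁ failure = inj₁ failure
... | inj₂ holds with P? T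
...   | no ¬PT = inj₁ (T , ¬PT , holds)
...   | yes PT = inj₂ λ s s<1+T → [ holds s , (λ { refl → PT }) ]′ (ℕ.m<1+n⇒m<n∨m≡n s<1+T)

∈-pigeonhole : (xs : List A) (f : ℕ → A) → (∀ s → s < suc (length xs) → f s ∈ xs) →
               ∃[ s ] ∃[ t ] s < t × t < suc (length xs) × f s ≡ f t
∈-pigeonhole xs f f∈ with Fin.pigeonhole (ℕ.n<1+n (length xs)) (λ k → index (f∈ (toℕ k) (Fin.toℕ<n k)))
... | i , j , i<j , eq = toℕ i , toℕ j , i<j , Fin.toℕ<n j ,
  trans (Any.lookup-index (f∈ (toℕ i) _)) (trans (cong (lookup xs) eq) (sym (Any.lookup-index (f∈ (toℕ j) _))))

-- A rectangle here is a product of two finite sets of coordinates, not necessarily of intervals.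
grid : List V → List V
grid P = cartesianProduct (map proj₁ P) (map proj₂ P)

⊆-grid : ∀ {P v} → v ∈ P → v ∈ grid P
⊆-grid v∈P = ∈-cartesianProduct⁺ (∈-map⁺ proj₁ v∈P) (∈-map⁺ proj₂ v∈P)

-- If no point of the grid has abscissa x, the vertical line through `u` misses the grid; otherwise
-- y is no ordinate of the grid and the horizontal line does.
grid-escape : ∀ P u → u ∉ grid P → ∃[ i ] u ⊕ dir i ∉ grid P × u ⊕ dir (back i) ∉ grid P
grid-escape P u@(x , y) u∉ with DecMembership._∈?_ ℤ._≟_ x (map proj₁ P)
... | no x∉ = 1F , outside , outside
  where
  outside : ∀ {z} → (x ℤ.+ ℤ.0ℤ , z) ∉ grid P
  outside v∈ = x∉ (subst (_∈ map proj₁ P) (ℤ.+-identityʳ x) (proj₁ (∈-cartesianProduct⁻ _ _ v∈)))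
... | yes x∈ = 0F , outside , outside
  where
  outside : ∀ {z} → (z , y ℤ.+ ℤ.0ℤ) ∉ grid P
  outside v∈ = u∉ (∈-cartesianProduct⁺ x∈
    (subst (_∈ map proj₂ P) (ℤ.+-identityʳ y) (proj₂ (∈-cartesianProduct⁻ (map proj₁ P) _ v∈))))

-- Coordinates may repeat in `P`, hence points in the grid; deduplication ensures that each vertex
-- is prescribed once.
gaps : List V → List V
gaps P = deduplicate _≟ᵛ_ (filter (_∉? P) (grid P))

gaps-++-unique : ∀ {P} → Unique P → Unique (gaps P ++ P)
gaps-++-unique {P} P! = Unique.++⁺ (deduplicate-! _≟ᵛ_ _) P!
  λ (v∈gaps , v∈P) → proj₂ (∈-filter⁻ (_∉? P) {xs = grid P} (∈-deduplicate⁻ _≟ᵛ_ _ v∈gaps)) v∈P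

gaps-++-⊆ : ∀ P {v} → v ∈ gaps P ++ P → v ∈ grid P
gaps-++-⊆ P v∈ with ∈-++⁻ (gaps P) v∈
... | inj₁ v∈gaps = proj₁ (∈-filter⁻ (_∉? P) (∈-deduplicate⁻ _≟ᵛ_ _ v∈gaps))
... | inj₂ v∈P    = ⊆-grid v∈P

gaps-++-⊇ : ∀ P {v} → v ∈ grid P → v ∈ gaps P ++ P
gaps-++-⊇ P {v} v∈ with v ∈? P
... | yes v∈P = ∈-++⁺ʳ (gaps P) v∈P
... | no  v∉P = ∈-++⁺ˡ (∈-deduplicate⁺ _≟ᵛ_ (∈-filter⁺ (_∉? P) v∈ v∉P))

-- Fresh crosses and labelings that steer the walk

-- The order is the one in which `refine sites` prepends the vertices, so this list is literally the
-- domain after refinement.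
FreshCross : V → Fin 4 → List V → Set
FreshCross u i P = Unique (u ⊕ dir (back i) ∷ u ⊕ dir i ∷ u ∷ P)

freshCross : ∀ {u i P} → Unique P → u ∉ P → u ⊕ dir i ∉ P → u ⊕ dir (back i) ∉ P → FreshCross u i P
freshCross {u} {i} {P} P! u∉ a∉ b∉ =
  ((λ eq → back-≢ i (sym (⊕-injectiveʳ u (back i) i eq))) ∷ ⊕-irrefl u (back i) ∷ All.¬Any⇒All¬ P b∉) ∷
  (⊕-irrefl u i ∷ All.¬Any⇒All¬ P a∉) ∷ All.¬Any⇒All¬ P u∉ ∷ P!

Steers : ∀ {v} → LocalLabeling v → Fin 4 → Fin 4 → Set
Steers {v} β p i = ∀ ω → ω v ≗ˡ β → step ω (v , p) ≡ (v ⊕ dir i , next p)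

permutation-steers : ∀ {v β} π → (enumerate v ↔-∘ π) ≗ˡ β → ∀ {p i} → π ⟨$⟩ʳ p ≡ i → Steers {v} β p i
permutation-steers {v} π eq {p} πp≡i ω ω≗β = cong (_, next p)
  (trans (cong proj₁ (trans (ω≗β p) (sym (eq p)))) (cong (λ j → v ⊕ dir j) πp≡i))

-- `labelings` is complete only up to pointwise agreement, so the desired rotation is replaced by a
-- listed representative. Being listed makes the closing cross one of the refinements.
record Pick (v : V) (p i : Fin 4) : Set where
  field
    labeling : LocalLabeling v
    listed   : labeling ∈ labelings v
    steers   : Steers {v} labeling p i
    steersʳ  : Steers {v} labeling (back p) (back i)

pick : ∀ v p i → Pick v p i
pick v p i =
  let π , πp , πq = turn p i
      β , β∈ , eq = find (labelings-complete {v} (enumerate v ↔-∘ π))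
  in record
    { labeling = β
    ; listed   = β∈
    ; steers   = permutation-steers {v} {β} π eq πp
    ; steersʳ  = permutation-steers {v} {β} π eq πq
    }

-- Abstract, because evaluating 1ℚ - closing is expensive.
abstract
  closing : ℚ
  closing = cell * cell * cell

  closing-≡ : closing ≡ cell * cell * cell
  closing-≡ = refl

  closing-pos : ℚ.Positive closing
  closing-pos = ℚ.pos*pos⇒pos (cell * cell) cell

  1-closing-nonNeg : ℚ.NonNegative (1ℚ - closing)
  1-closing-nonNeg = ℚ.nonNegative (begin
    0ℚ                 ≡⟨ ℚ.+-inverseʳ closing ⟨
    closing - closing  ≤⟨ ℚ.+-monoˡ-≤ (ℚ.- closing) closing≤1 ⟩
    1ℚ - closing       ∎)
    where
    open ℚ.≤-Reasoning

    cell≤1 : cell ≤ 1ℚ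
    cell≤1 = from-yes (cell ℚ.≤? 1ℚ)

    shrink : ∀ q .{{_ : ℚ.NonNegative q}} → q * cell ≤ q
    shrink q = ℚ.≤-trans (ℚ.*-monoˡ-≤-nonNeg q cell≤1) (ℚ.≤-reflexive (ℚ.*-identityʳ q))

    closing≤1 : closing ≤ 1ℚ
    closing≤1 = ℚ.≤-trans (shrink (cell * cell)) (ℚ.≤-trans (shrink cell) cell≤1)

-- The loop u → u ⊕ dir i → u → u ⊕ dir (back i) → u takes four steps, hence returns to the initial port.
module Loop (u : V) (p i : Fin 4) where

  centre : Pick u p i
  centre = pick u p i

  ahead : Pick (u ⊕ dir i) (next p) (back i)
  ahead = pick _ _ _

  -- The heading is `i` again, kept in the form that `⊕-back` cancels.
  behind : Pick (u ⊕ dir (back i)) (next (back p)) (back (back i))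
  behind = pick _ _ _

  sites : List V
  sites = u ⊕ dir (back i) ∷ u ⊕ dir i ∷ u ∷ []

  cross : Prescription → Prescription
  cross L = (_ , Pick.labeling behind) ∷ (_ , Pick.labeling ahead) ∷ (_ , Pick.labeling centre) ∷ L

  cross-listed : ∀ L → cross L ∈ refine sites L
  cross-listed L = refine-∈ {F = u ⊕ dir i ∷ u ∷ []} (Pick.listed behind)
    (refine-∈ {F = u ∷ []} (Pick.listed ahead) (refine-∈ {F = []} (Pick.listed centre) (here refl)))

  -- The three labelings of the cross contribute one factor 1/24 each.
  cross-weight : ∀ L → weight L - weight (cross L) ≡ (1ℚ - closing) * weight L
  cross-weight L = trans (identity cell (weight L)) (cong (λ c → (1ℚ - c) * weight L) (sym closing-≡))
    where
    identity : ∀ k w → w - k * (k * (k * w)) ≡ (1ℚ - k * k * k) * w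
    identity = solve 2 (λ k w → w :- k :* (k :* (k :* w)) := (con 1ℚ :- k :* k :* k) :* w) refl
      where open +-*-Solver

  cross-closes : ∀ ω L → ω ∈ᵖ cross L → step ω (step ω (step ω (step ω (u , p)))) ≡ (u , p)
  cross-closes ω L (ω≗b ∷ ω≗a ∷ ω≗c ∷ _) = begin
    step ω (step ω (step ω (step ω (u , p))))
      ≡⟨ cong (λ σ → step ω (step ω (step ω σ))) (Pick.steers centre ω ω≗c) ⟩
    step ω (step ω (step ω (u ⊕ dir i , next p)))
      ≡⟨ cong (λ σ → step ω (step ω σ)) (Pick.steers ahead ω ω≗a) ⟩
    step ω (step ω ((u ⊕ dir i) ⊕ dir (back i) , back p))
      ≡⟨ cong (λ v → step ω (step ω (v , back p))) (⊕-back u i) ⟩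
    step ω (step ω (u , back p))
      ≡⟨ cong (step ω) (Pick.steersʳ centre ω ω≗c) ⟩
    step ω (u ⊕ dir (back i) , next (back p))
      ≡⟨ Pick.steers behind ω ω≗b ⟩
    ((u ⊕ dir (back i)) ⊕ dir (back (back i)) , back (back p))
      ≡⟨ cong₂ _,_ (⊕-back u (back i)) (next⁴ p) ⟩
    (u , p) ∎
    where open ≡-Reasoning

-- Coverings of the labelings that do not cycle

module _ (v₀ : V) (ℓ : Fin 4) where

  start : State
  start = v₀ , ℓ

  -- An undecided cell: its labelings all bring the walk to the same state, at a vertex whose cross
  -- is still free to close the loop.
  record Node : Set where
    field
      pre     : Prescription
      site    : V
      port    : Fin 4
      heading : Fin 4
      fresh   : FreshCross site heading (domain pre)
      reached : ∀ ω → ω ∈ᵖ pre → ∃[ t ] walk ω start t ≡ (site , port)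

  open Node

  cylinder : Node → Cylinder
  cylinder n = record { prescribed = pre n ; distinct = Unique.drop⁺ 3 (fresh n) }

  mass : List Node → ℚ
  mass = total (weight ∘ pre)

  -- Cycling labelings in `E` may stay uncovered; this is where mass is saved.
  Covering : Pred Labeling 0ℓ → ℚ → Set
  Covering E q = Σ[ ns ∈ List Node ] mass ns ≤ q × (∀ ω → E ω → ¬ Cycles v₀ ℓ ω → Any (λ n → ω ∈ᵖ pre n) ns)

  weaken : ∀ {E F p q} → (∀ ω → F ω → E ω) → p ≤ q → Covering E p → Covering F q
  weaken F⊆E p≤q (ns , bound , covers) = ns , ℚ.≤-trans bound p≤q , λ ω → covers ω ∘ F⊆E ω

  covering-∅ : ∀ {E} → (∀ ω → E ω → Cycles v₀ ℓ ω) → Covering E 0ℚ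
  covering-∅ cycles = [] , ℚ.≤-refl , λ ω ω∈E ¬c → contradiction (cycles ω ω∈E) ¬c

  covering-∪ : ∀ {E F p q} → Covering E p → Covering F q → Covering (E ∪ F) (p + q)
  covering-∪ (ns , bound , covers) (ns′ , bound′ , covers′) = ns ++ ns′ ,
    ℚ.≤-trans (ℚ.≤-reflexive (total-++ (weight ∘ pre) ns ns′)) (ℚ.+-mono-≤ bound bound′) ,
    λ { ω (inj₁ ω∈E) ¬c → Any.++⁺ˡ (covers ω ω∈E ¬c) ; ω (inj₂ ω∈F) ¬c → Any.++⁺ʳ ns (covers′ ω ω∈F ¬c) }

  covering-⋃ : {E : A → Pred Labeling 0ℓ} {f : A → ℚ} {xs : List A} → All (λ x → Covering (E x) (f x)) xs →
               Covering (λ ω → Any (λ x → E x ω) xs) (total f xs)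
  covering-⋃ []       = covering-∅ λ _ ()
  covering-⋃ {E = E} (c ∷ cs) = weaken {E = E _ ∪ _} (λ _ → Any.toSum) ℚ.≤-refl (covering-∪ c (covering-⋃ cs))

  -- All of `E x` cycles, so the empty list covers it and `f x` is saved.
  covering-⋃-except : {E : A → Pred Labeling 0ℓ} {f : A → ℚ} {x : A} {xs : List A} →
                      x ∈ xs → (∀ ω → E x ω → Cycles v₀ ℓ ω) → All (λ x → Covering (E x) (f x)) xs →
                      Covering (λ ω → Any (λ x → E x ω) xs) (total f xs - f x)
  covering-⋃-except {E = E} {f} {x} {xs = _ ∷ xs} (here refl) cycles (_ ∷ cs) =
    weaken {E = E x ∪ _} (λ _ → Any.toSum) (ℚ.≤-reflexive (identity (f x) (total f xs)))
           (covering-∪ (covering-∅ cycles) (covering-⋃ cs))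
    where
    identity : ∀ a b → 0ℚ + b ≡ (a + b) - a
    identity = solve 2 (λ a b → con 0ℚ :+ b := (a :+ b) :- a) refl
      where open +-*-Solver
  covering-⋃-except {E = E} {f} {x} {xs = y ∷ xs} (there x∈) cycles (c ∷ cs) =
    weaken {E = E y ∪ _} (λ _ → Any.toSum) (ℚ.≤-reflexive (sym (ℚ.+-assoc (f y) (total f xs) (ℚ.- f x))))
           (covering-∪ c (covering-⋃-except x∈ cycles cs))

  -- Once a whole rectangle is prescribed, the walk inside it is determined:
  -- either it repeats a state by pigeonhole or it leaves the rectangle.
  explore : ∀ P L → Unique (domain L) → (∀ {v} → v ∈ domain L → v ∈ grid P) →
            (∀ {v} → v ∈ grid P → v ∈ domain L) → Covering (_∈ᵖ L) (weight L)
  explore P L L! L⊆grid grid⊆L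
    -- One more time than there are entries in `states`, so that a walk staying inside must repeat a
    -- state.
    with first-failure (λ t → position (assign L) start t ∈? grid P) (suc (length states))
    where
    states : List State
    states = cartesianProduct (grid P) (allFin 4)
  ... | inj₁ (t , u∉ , inside) with grid-escape P (position (assign L) start t) u∉
  ...   | i , a∉ , b∉ = node ∷ [] , ℚ.≤-reflexive (ℚ.+-identityʳ (weight L)) , λ ω ω∈L _ → here ω∈L
    where
    node : Node
    node = record
      { pre     = L
      ; site    = position (assign L) start t
      ; port    = proj₂ (walk (assign L) start t)
      ; heading = i
      ; fresh   = freshCross {i = i} L! (u∉ ∘ L⊆grid) (a∉ ∘ L⊆grid) (b∉ ∘ L⊆grid)
      ; reached = λ ω ω∈L → t , walk-agrees L ω start t ω∈L (λ s s<t → grid⊆L (inside s s<t))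
      }
  explore P L L! L⊆grid grid⊆L | inj₂ inside
    with ∈-pigeonhole (cartesianProduct (grid P) (allFin 4)) (walk (assign L) start)
           (λ s s< → ∈-cartesianProduct⁺ (inside s s<) (∈-allFin _))
  ... | s , t , s<t , t≤ , eq = weaken {E = _∈ᵖ L} (λ _ ω∈L → ω∈L)
    (ℚ.nonNegative⁻¹ (weight L) {{weight-nonNeg L}}) (covering-∅ repeats)
    where
    agrees : ∀ ω → ω ∈ᵖ L → ∀ r → r < suc t → walk ω start r ≡ walk (assign L) start r
    agrees ω ω∈L r r≤t = walk-agrees L ω start r ω∈L
      λ q q<r → grid⊆L (inside q (ℕ.<-trans q<r (ℕ.≤-<-trans (ℕ.s≤s⁻¹ r≤t) t≤)))

    repeats : ∀ ω → ω ∈ᵖ L → Cycles v₀ ℓ ω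
    repeats ω ω∈L = repeat⇒cycles {ω = ω} s<t
      (trans (agrees ω ω∈L s (ℕ.m<n⇒m<1+n s<t)) (trans eq (sym (agrees ω ω∈L t ℕ.≤-refl))))

  -- Filling the gaps of the rectangle keeps the total weight by `refine-total`, and `explore`
  -- treats each resulting cell.
  advance : ∀ D → Unique (domain D) → Covering (_∈ᵖ D) (weight D)
  advance D D! = weaken (λ ω → refine-complete (gaps P) ω) (ℚ.≤-reflexive (refine-total (gaps P) D))
    (covering-⋃ (All.map (λ {L} → filled {L}) (refine-domain (gaps P) D)))
    where
    P = domain D

    filled : ∀ {L} → domain L ≡ gaps P ++ P → Covering (_∈ᵖ L) (weight L)
    filled {L} eq = explore P L (subst Unique (sym eq) (gaps-++-unique D!))
      (λ v∈ → gaps-++-⊆ P (subst (_ ∈_) eq v∈)) (λ v∈ → subst (_ ∈_) (sym eq) (gaps-++-⊇ P v∈))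

  -- Among the refinements at the three sites, `cross` closes the loop and is discarded, which saves
  -- the fraction `closing`; the others are passed to `advance`.
  expand : ∀ n → Covering (_∈ᵖ pre n) ((1ℚ - closing) * weight (pre n))
  expand n = weaken {E = λ ω → Any (ω ∈ᵖ_) (refine sites (pre n))} (λ ω → refine-complete sites ω)
    (ℚ.≤-reflexive (trans (cong (_- weight (cross (pre n))) (refine-total sites (pre n))) (cross-weight (pre n))))
    (covering-⋃-except {E = λ D → _∈ᵖ D} {f = weight} (cross-listed (pre n)) closed
      (All.map (λ {D} eq → advance D (subst Unique (sym eq) (fresh n))) (refine-domain sites (pre n))))
    where
    open Loop (site n) (port n) (heading n)

    closed : ∀ ω → ω ∈ᵖ cross (pre n) → Cycles v₀ ℓ ω
    closed ω ω∈@(_ ∷ _ ∷ _ ∷ ω∈pre) =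
      let t , eq = reached n ω ω∈pre
      in repeat⇒cycles {ω = ω} {s = t} {t = 4 ℕ.+ t} (ℕ.m<n+m t {4} z<s)
           (trans eq (sym (trans (cong (λ σ → step ω (step ω (step ω (step ω σ)))) eq) (cross-closes ω (pre n) ω∈))))

  root : Node
  root = record
    { pre     = []
    ; site    = v₀
    ; port    = ℓ
    -- Nothing is prescribed yet, so any heading gives a fresh cross.
    ; heading = 0F
    ; fresh   = freshCross {i = 0F} [] (λ ()) (λ ()) (λ ())
    ; reached = λ ω _ → 0 , refl
    }

  stage : ∀ N → Covering (λ _ → ⊤) (power (1ℚ - closing) N)
  stage zero    = root ∷ [] , ℚ.≤-refl , λ _ _ _ → here []
  stage (suc N) =
    let ns , bound , covers = stage N
        ns′ , bound′ , covers′ = covering-⋃ {E = λ n → _∈ᵖ pre n} (All.universal expand ns)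
    in ns′ ,
       ℚ.≤-trans bound′ (ℚ.≤-trans (ℚ.≤-reflexive (total-*ˡ (1ℚ - closing) (weight ∘ pre) ns))
                                    (ℚ.*-monoˡ-≤-nonNeg (1ℚ - closing) {{1-closing-nonNeg}} bound)) ,
       λ ω _ ¬c → covers′ ω (covers ω _ ¬c) ¬c

  -- From finite coverings to sequences of cylinders

  -- `Null` asks for an infinite sequence; the padding `nothing` has probability 0.
  sequence : List Node → ℕ → Maybe Cylinder
  sequence []       k       = nothing
  sequence (n ∷ ns) zero    = just (cylinder n)
  sequence (n ∷ ns) (suc k) = sequence ns k

  sequence-∈ : ∀ ω {ns} → Any (λ n → ω ∈ᵖ pre n) ns → ∃[ k ] ∃[ D ] sequence ns k ≡ just D × ω ∈ᶜ D
  sequence-∈ ω (here {n} ω∈) = 0 , cylinder n , refl , ω∈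
  sequence-∈ ω (there ω∈) with sequence-∈ ω ω∈
  ... | k , found = suc k , found

  mass-≥0 : ∀ ns → 0ℚ ≤ mass ns
  mass-≥0 []       = ℚ.≤-refl
  mass-≥0 (n ∷ ns) = ℚ.+-mono-≤ (ℚ.nonNegative⁻¹ (weight (pre n)) {{weight-nonNeg (pre n)}}) (mass-≥0 ns)

  sequence-partialSum : ∀ ns k → partialSum (sequence ns) k ≤ mass ns
  -- Stopping early only omits nonnegative terms.
  sequence-partialSum ns       zero    = mass-≥0 ns
  sequence-partialSum []       (suc k) = ℚ.≤-trans (ℚ.≤-reflexive (ℚ.+-identityˡ _)) (sequence-partialSum [] k)
  sequence-partialSum (n ∷ ns) (suc k) = ℚ.+-monoʳ-≤ (weight (pre n)) (sequence-partialSum ns k)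

theorem4p1 : (v₀ : Graph.V ℤ²) (ℓ : Fin (Graph.deg ℤ² v₀)) →
    RandomLabeling.WithProbabilityOne ℤ² (BasicWalk.Cycles ℤ² v₀ ℓ)
theorem4p1 v₀ ℓ δ δ>0 =
  let N , small = power-vanishes closing {{closing-pos}} {{1-closing-nonNeg}} δ {{ℚ.positive δ>0}}
      ns , bound , covers = stage v₀ ℓ N
  in sequence v₀ ℓ ns ,
     (λ ω ¬c → sequence-∈ v₀ ℓ ω (covers ω _ ¬c)) ,
     λ k → ℚ.≤-trans (sequence-partialSum v₀ ℓ ns k) (ℚ.≤-trans bound small)
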